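{- Contractive increasing boolean operators are not finitely generated: there is no finite set $G$ of contractive increasing boolean operators (of possibly different arities) such that, for every natural number $n$, every contractive increasing boolean operator $f:\mathbf{B}^n\to\mathbf{B}^n$ is generated by $G$.
   Context: $\mathbf{B}=\{0,1\}$ with $0\le 1$, and $\mathbf{B}^n$ carries the pointwise order. The weight $|u|$ of $u\in\mathbf{B}^n$ is the number of $1$s in $u$. A contractive increasing boolean operator of arity $n$ is a function $f:\mathbf{B}^n\to\mathbf{B}^n$ that is increasing ($u\le v$ implies $f(u)\le f(v)$) and contractive ($|f(u)|\le|u|$ for all $u\in\mathbf{B}^n$). Generation is in the sense of boolean circuits built from cells (i.e. generation as a monoidal category): the set of operators generated by a set $G$ of operators ("cells") is the smallest collection of operators that contains $G$ and all identities $\mathrm{id}:\mathbf{B}^n\to\mathbf{B}^n$ ($n\ge 0$), and is closed under sequential composition ($f,g:\mathbf{B}^n\to\mathbf{B}^n$ gives $g\circ f$) and parallel composition ($f:\mathbf{B}^p\to\mathbf{B}^p$ and $g:\mathbf{B}^q\to\mathbf{B}^q$ give $f\times g:\mathbf{B}^{p+q}\to\mathbf{B}^{p+q}$, acting as $f$ on the first $p$ coordinates and as $g$ on the last $q$ coordinates). The crossing $(b_1,b_2)\mapsto(b_2,b_1)$ is itself a contractive increasing boolean operator and may belong to $G$. -}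

module Defs where

open import Data.Bool.Base using (Bool; true; _≤_)
open import Data.Bool.Properties using (_≟_)
open import Data.List.Base using (List)
open import Data.List.Membership.Propositional using (_∈_)
open import Data.Nat.Base as ℕ using (ℕ; _+_)
open import Data.Product.Base using (∃; _,_)
open import Data.Vec.Base using (Vec; count; take; drop; _++_)
open import Data.Vec.Relation.Binary.Pointwise.Inductive using (Pointwise)
open import Function.Base using (id; _∘_)
open import Relation.Binary.Core using (_Preserves_⟶_)
open import Relation.Binary.PropositionalEquality.Core using (_≗_)

infix 4 _≼_
infixr 7 _⊗_

_≼_ : ∀ {n} → Vec Bool n → Vec Bool n → Set
_≼_ = Pointwise _≤_

weight : ∀ {n} → Vec Bool n → ℕ
weight = count (_≟ true)

Operator : ℕ → Set
Operator n = Vec Bool n → Vec Bool n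

record IsContractiveIncreasing {n : ℕ} (f : Operator n) : Set where
  field
    increasing  : f Preserves _≼_ ⟶ _≼_
    contractive : ∀ u → weight (f u) ℕ.≤ weight u

_⊗_ : ∀ {p q} → Operator p → Operator q → Operator (p + q)
_⊗_ {p} f g u = f (take p u) ++ g (drop p u)

-- Operators are functions considered up to pointwise equality; in the
-- absence of function extensionality this is what `resp` accounts for.

data Generated (G : List (∃ Operator)) : ∀ {n} → Operator n → Set where
  cell     : ∀ {n} {f : Operator n} → (n , f) ∈ G → Generated G f
  identity : ∀ {n} → Generated G (id {A = Vec Bool n})
  seq      : ∀ {n} {f g : Operator n} →
             Generated G f → Generated G g → Generated G (g ∘ f)
  par      : ∀ {p q} {f : Operator p} {g : Operator q} →
             Generated G f → Generated G g → Generated G (f ⊗ g)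
  resp     : ∀ {n} {f g : Operator n} →
             f ≗ g → Generated G f → Generated G g

{-# OPTIONS --safe #-}

-- Suppose all cells have arity at most s.  Call an operator s-faithful when, on
-- the inputs with at most s zeros, it preserves weight and is injective.
-- Faithfulness passes to the factors of a sequential composition (the first
-- factor is a weight-preserving injection of a finite set, hence permutes it)
-- and of a parallel one (feed ones to the other factor).  On a cell every input
-- has at most s zeros, so a generated s-faithful operator preserves all weights.
-- The operator of arity s + 2 that erases the inputs of weight less than 2 and
-- fixes all others is s-faithful, but does not preserve weight 1.
module Submission where

open import Defs
open import Data.Bool.Base using (Bool; true; false; f≤t; b≤b)
open import Data.Bool.Properties using (≤-minimum; ≤-refl)
open import Data.Fin.Base using (Fin; toℕ; finToFun; funToFin)
open import Data.Fin.Properties using (2↔Bool; finToFun-funToFin; pigeonhole)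
open import Data.List.Base using (List; map)
open import Data.List.Extrema.Nat using (max; xs≤max)
open import Data.List.Membership.Propositional using (_∈_)
open import Data.List.Membership.Propositional.Properties using (∈-map⁺)
open import Data.List.Relation.Unary.All as All using (All)
open import Data.Nat.Base using (ℕ; zero; suc; _+_; _^_; _≤_; _<_; z≤n; s≤s; s<s⁻¹)
open import Data.Nat.Properties
  using ( ≤-trans; ≤-antisym; ≤-reflexive; <⇒≱; m≤n⇒m≤1+n; n<1+n; m≤n⇒m≤n+o; _≤?_
        ; +-assoc; +-comm; +-suc; +-mono-≤; +-monoˡ-≤; +-monoʳ-≤
        ; +-cancelˡ-≤; +-cancelʳ-≤; module ≤-Reasoning)
open import Data.Product.Base using (∃; Σ; _×_; _,_; proj₁; proj₂)
open import Data.Vec.Base using (Vec; []; _∷_; _++_; take; drop; lookup; replicate; tabulate)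
open import Data.Vec.Properties
  using (take++drop≡id; ++-injective; ++-injectiveˡ; ++-injectiveʳ; tabulate∘lookup; tabulate-cong)
open import Data.Vec.Relation.Binary.Pointwise.Inductive as Pointwise using ([]; _∷_)
open import Function.Base using (_∘_)
open import Function.Bundles using (Inverse)
open import Relation.Binary.PropositionalEquality
  using (_≡_; _≗_; refl; sym; trans; cong; cong₂; subst; module ≡-Reasoning)
open import Relation.Nullary.Decidable.Core using (yes; no)
open import Relation.Nullary.Negation.Core using (¬_; contradiction)

private
  variable
    n p q s : ℕ
    f g : Operator n

-- Weights, the pointwise order and parallel composition

weight-++ : (u : Vec Bool p) (v : Vec Bool q) → weight (u ++ v) ≡ weight u + weight v
weight-++ []          v = refl
weight-++ (true  ∷ u) v = cong suc (weight-++ u v)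
weight-++ (false ∷ u) v = weight-++ u v

weight-trues : ∀ n → weight (replicate n true) ≡ n
weight-trues zero    = refl
weight-trues (suc n) = cong suc (weight-trues n)

weight-falses : ∀ n → weight (replicate n false) ≡ 0
weight-falses zero    = refl
weight-falses (suc n) = weight-falses n

weight-mono : {u v : Vec Bool n} → u ≼ v → weight u ≤ weight v
weight-mono []                          = z≤n
weight-mono (f≤t ∷ u≼v)                 = m≤n⇒m≤1+n (weight-mono u≼v)
weight-mono {u = true  ∷ _} (b≤b ∷ u≼v) = s≤s (weight-mono u≼v)
weight-mono {u = false ∷ _} (b≤b ∷ u≼v) = weight-mono u≼v

falses-minimum : (u : Vec Bool n) → replicate n false ≼ u
falses-minimum []      = []
falses-minimum (b ∷ u) = ≤-minimum b ∷ falses-minimum u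

⊗-++ : ∀ (f : Operator p) (g : Operator q) u v → (f ⊗ g) (u ++ v) ≡ f u ++ g v
⊗-++ {p} f g u v
  with take≡u , drop≡v ← ++-injective (take p (u ++ v)) u (take++drop≡id p (u ++ v))
  = cong₂ (λ a b → f a ++ g b) take≡u drop≡v

-- Slack in one inequality could not be made up by the other. This splits preservation of total
-- weight between the two factors of a parallel composition.
+-squeeze : ∀ {a b c d} → a ≤ b → c ≤ d → a + c ≡ b + d → a ≡ b × c ≡ d
+-squeeze {a} {b} {c} {d} a≤b c≤d eq =
  ≤-antisym a≤b (+-cancelʳ-≤ d b a (≤-trans (≤-reflexive (sym eq)) (+-monoʳ-≤ a c≤d))) ,
  ≤-antisym c≤d (+-cancelˡ-≤ b d c (≤-trans (≤-reflexive (sym eq)) (+-monoˡ-≤ c a≤b)))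

Contractive : Operator n → Set
Contractive f = ∀ u → weight (f u) ≤ weight u

Conservative : Operator n → Set
Conservative f = ∀ u → weight (f u) ≡ weight u

⊗-weight : ∀ (f : Operator p) (g : Operator q) u →
           weight ((f ⊗ g) u) ≡ weight (f (take p u)) + weight (g (drop p u))
⊗-weight {p} f g u = weight-++ (f (take p u)) (g (drop p u))

take-drop-weight : ∀ p (u : Vec Bool (p + q)) → weight (take p u) + weight (drop p u) ≡ weight u
take-drop-weight p u = trans (sym (weight-++ (take p u) (drop p u))) (cong weight (take++drop≡id p u))

⊗-contractive : ∀ (f : Operator p) (g : Operator q) →
                Contractive f → Contractive g → Contractive (f ⊗ g)
⊗-contractive {p} f g cf cg u = begin
  weight ((f ⊗ g) u)                              ≡⟨ ⊗-weight f g u ⟩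
  weight (f (take p u)) + weight (g (drop p u))   ≤⟨ +-mono-≤ (cf (take p u)) (cg (drop p u)) ⟩
  weight (take p u) + weight (drop p u)           ≡⟨ take-drop-weight p u ⟩
  weight u                                        ∎
  where open ≤-Reasoning

⊗-conservative : ∀ (f : Operator p) (g : Operator q) →
                 Conservative f → Conservative g → Conservative (f ⊗ g)
⊗-conservative {p} f g cf cg u = begin
  weight ((f ⊗ g) u)                              ≡⟨ ⊗-weight f g u ⟩
  weight (f (take p u)) + weight (g (drop p u))   ≡⟨ cong₂ _+_ (cf (take p u)) (cg (drop p u)) ⟩
  weight (take p u) + weight (drop p u)           ≡⟨ take-drop-weight p u ⟩
  weight u                                        ∎
  where open ≡-Reasoning

-- Heavy vectors and faithful operators

-- At most s of the n bits are zeros, stated without subtraction.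
Heavy : ℕ → Vec Bool n → Set
Heavy {n} s u = n ≤ s + weight u

-- Injectivity is included for the sake of the second factor of `g ∘ f`: it makes `f` surjective on
-- heavy vectors, so that `g` is controlled on all of them.
record Faithful (s : ℕ) (f : Operator n) : Set where
  field
    conservative : ∀ u → Heavy s u → weight (f u) ≡ weight u
    injective    : ∀ u v → Heavy s u → Heavy s v → f u ≡ f v → u ≡ v

  heavy : ∀ u → Heavy s u → Heavy s (f u)
  heavy u h = subst (λ w → n ≤ s + w) (sym (conservative u h)) h

open Faithful

-- Padding with ones adds no zeros.
heavy-++-trues : ∀ (u : Vec Bool p) q → Heavy s u → Heavy s (u ++ replicate q true)
heavy-++-trues {p} {s} u q h = begin
  p + q                                      ≤⟨ +-monoˡ-≤ q h ⟩
  s + weight u + q                           ≡⟨ +-assoc s (weight u) q ⟩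
  s + (weight u + q)                         ≡⟨ cong (λ w → s + (weight u + w)) (weight-trues q) ⟨
  s + (weight u + weight (replicate q true)) ≡⟨ cong (s +_) (weight-++ u (replicate q true)) ⟨
  s + weight (u ++ replicate q true)         ∎
  where open ≤-Reasoning

heavy-trues-++ : ∀ p (v : Vec Bool q) → Heavy s v → Heavy s (replicate p true ++ v)
heavy-trues-++         zero    v h = h
heavy-trues-++ {q} {s} (suc p) v h = begin
  suc (p + q)                                   ≤⟨ s≤s (heavy-trues-++ p v h) ⟩
  suc (s + weight (replicate p true ++ v))      ≡⟨ +-suc s _ ⟨
  s + suc (weight (replicate p true ++ v))      ∎
  where open ≤-Reasoning

-- Places the bit vectors in a finite type to which the pigeonhole principle applies.
encode : Vec Bool n → Fin (2 ^ n)
encode u = funToFin (Inverse.from 2↔Bool ∘ lookup u)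

encode-injective : ∀ (u v : Vec Bool n) → encode u ≡ encode v → u ≡ v
encode-injective u v eq = begin
  u                    ≡⟨ tabulate∘lookup u ⟨
  tabulate (lookup u)  ≡⟨ tabulate-cong same-bits ⟩
  tabulate (lookup v)  ≡⟨ tabulate∘lookup v ⟩
  v                    ∎
  where
  open ≡-Reasoning
  open Inverse 2↔Bool using (to; from; strictlyInverseˡ)

  same-bits : lookup u ≗ lookup v
  same-bits i = begin
    lookup u i                 ≡⟨ strictlyInverseˡ (lookup u i) ⟨
    to (from (lookup u i))     ≡⟨ cong to (finToFun-funToFin (from ∘ lookup u) i) ⟨
    to (finToFun (encode u) i) ≡⟨ cong (λ k → to (finToFun k i)) eq ⟩
    to (finToFun (encode v) i) ≡⟨ cong to (finToFun-funToFin (from ∘ lookup v) i) ⟩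
    to (from (lookup v i))     ≡⟨ strictlyInverseˡ (lookup v i) ⟩
    lookup v i                 ∎

-- The orbit of v under f is eventually periodic, and by injectivity it returns to v.
faithful⇒surjective : Faithful s f → ∀ v → Heavy s v → ∃ λ u → Heavy s u × f u ≡ v
faithful⇒surjective {s} {n} {f} faithful v hv =
  -- The indices form `Fin (1 + 2 ^ n)`, one more than there are vectors, so two of these orbit
  -- points coincide.
  let i , j , i<j , eq = pigeonhole (n<1+n (2 ^ n)) (encode ∘ orbit ∘ toℕ)
  in cancel (toℕ i) (toℕ j) i<j (encode-injective _ _ eq)
  where
  orbit : ℕ → Vec Bool n
  orbit zero    = v
  orbit (suc i) = f (orbit i)

  orbit-heavy : ∀ i → Heavy s (orbit i)
  orbit-heavy zero    = hv
  orbit-heavy (suc i) = heavy faithful (orbit i) (orbit-heavy i)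

  cancel : ∀ i j → i < j → orbit i ≡ orbit j → ∃ λ u → Heavy s u × f u ≡ v
  -- Cancelling `f` lowers both indices together; once the smaller is zero, the collision exhibits
  -- `v` as the image of an orbit point.
  cancel zero    (suc j) _   eq = orbit j , orbit-heavy j , sym eq
  cancel (suc i) (suc j) i<j eq =
    cancel i j (s<s⁻¹ i<j) (injective faithful _ _ (orbit-heavy i) (orbit-heavy j) eq)

-- Faithfulness of the factors of a composition

-- Weight lost by `f` cannot be regained by `g`, and inputs merged by `f` stay merged.
faithful-∘ʳ : ∀ (f g : Operator n) → Contractive f → Contractive g →
              Faithful s (g ∘ f) → Faithful s f
faithful-∘ʳ f g cf cg faithful = record
  { conservative = λ u h →
      ≤-antisym (cf u) (≤-trans (≤-reflexive (sym (conservative faithful u h))) (cg (f u)))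
  ; injective    = λ u v hu hv eq → injective faithful u v hu hv (cong g eq)
  }

-- Each heavy vector is `f u` for some heavy `u`, so what `g` does there can be read off from
-- `g ∘ f` at `u`.
faithful-∘ˡ : ∀ (f g : Operator n) → Faithful s f → Faithful s (g ∘ f) → Faithful s g
faithful-∘ˡ {s = s} f g faithful-f faithful-gf = record
  { conservative = conservative-g ; injective = injective-g }
  where
  conservative-g : ∀ v → Heavy s v → weight (g v) ≡ weight v
  conservative-g v hv with u , hu , refl ← faithful⇒surjective faithful-f v hv =
    trans (conservative faithful-gf u hu) (sym (conservative faithful-f u hu))

  injective-g : ∀ v v′ → Heavy s v → Heavy s v′ → g v ≡ g v′ → v ≡ v′
  injective-g v v′ hv hv′ eq
    with u  , hu  , refl ← faithful⇒surjective faithful-f v hv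
    with u′ , hu′ , refl ← faithful⇒surjective faithful-f v′ hv′
    = cong f (injective faithful-gf u u′ hu hu′ eq)

⊗-conservative⁻ : ∀ (f : Operator p) (g : Operator q) → Contractive f → Contractive g →
                  ∀ u v → weight ((f ⊗ g) (u ++ v)) ≡ weight (u ++ v) →
                  weight (f u) ≡ weight u × weight (g v) ≡ weight v
⊗-conservative⁻ f g cf cg u v eq = +-squeeze (cf u) (cg v) (begin
  weight (f u) + weight (g v)   ≡⟨ weight-++ (f u) (g v) ⟨
  weight (f u ++ g v)           ≡⟨ cong weight (⊗-++ f g u v) ⟨
  weight ((f ⊗ g) (u ++ v))     ≡⟨ eq ⟩
  weight (u ++ v)               ≡⟨ weight-++ u v ⟩
  weight u + weight v           ∎)
  where open ≡-Reasoning

⊗-cong-++ : ∀ (f : Operator p) (g : Operator q) u u′ v v′ → f u ≡ f u′ → g v ≡ g v′ →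
            (f ⊗ g) (u ++ v) ≡ (f ⊗ g) (u′ ++ v′)
⊗-cong-++ f g u u′ v v′ eq eq′ =
  trans (⊗-++ f g u v) (trans (cong₂ _++_ eq eq′) (sym (⊗-++ f g u′ v′)))

-- Feeding ones to `g` keeps the joint input heavy; the common padding then drops out of both
-- conditions.
faithful-⊗ˡ : ∀ (f : Operator p) (g : Operator q) → Contractive f → Contractive g →
              Faithful s (f ⊗ g) → Faithful s f
faithful-⊗ˡ {q = q} f g cf cg faithful = record
  { conservative = λ u h → proj₁ (⊗-conservative⁻ f g cf cg u 1s
      (conservative faithful (u ++ 1s) (heavy-++-trues u q h)))
  ; injective    = λ u v hu hv eq → ++-injectiveˡ u v
      (injective faithful (u ++ 1s) (v ++ 1s) (heavy-++-trues u q hu) (heavy-++-trues v q hv)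
        (⊗-cong-++ f g u v 1s 1s eq refl))
  }
  where 1s = replicate q true

faithful-⊗ʳ : ∀ (f : Operator p) (g : Operator q) → Contractive f → Contractive g →
              Faithful s (f ⊗ g) → Faithful s g
faithful-⊗ʳ {p} f g cf cg faithful = record
  { conservative = λ v h → proj₂ (⊗-conservative⁻ f g cf cg 1s v
      (conservative faithful (1s ++ v) (heavy-trues-++ p v h)))
  ; injective    = λ u v hu hv eq → ++-injectiveʳ 1s 1s
      (injective faithful (1s ++ u) (1s ++ v) (heavy-trues-++ p u hu) (heavy-trues-++ p v hv)
        (⊗-cong-++ f g 1s 1s u v refl eq))
  }
  where 1s = replicate p true

-- Operators generated by cells of bounded arity

module _ {G : List (∃ Operator)} (G-contractive : All (λ c → Contractive (proj₂ c)) G) where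

  generated-contractive : Generated G f → Contractive f
  generated-contractive (cell c∈G)  = All.lookup G-contractive c∈G
  generated-contractive identity u  = ≤-reflexive refl
  generated-contractive (seq {f = f} F H) u =
    ≤-trans (generated-contractive H (f u)) (generated-contractive F u)
  generated-contractive (par {f = f} {g} F H) =
    ⊗-contractive f g (generated-contractive F) (generated-contractive H)
  generated-contractive (resp f≗g F) u =
    subst (λ v → weight v ≤ weight u) (f≗g u) (generated-contractive F u)

  -- Induction on the circuit: faithfulness is handed down to the cells, and conservativity is
  -- passed back up.
  generated-faithful⇒conservative : (∀ {c} → c ∈ G → proj₁ c ≤ s) →
                                    Generated G f → Faithful s f → Conservative f
  generated-faithful⇒conservative {s} arity≤s = go
    where
    go : Generated G f → Faithful s f → Conservative f
    -- A cell has at most `s` inputs, hence at most `s` zeros: every input is heavy.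
    go (cell c∈G) faithful u = conservative faithful u (m≤n⇒m≤n+o (weight u) (arity≤s c∈G))
    go identity   faithful u = refl
    go (seq {f = f} {g} F H) faithful u = trans (go H faithful-g (f u)) (go F faithful-f u)
      where
      faithful-f = faithful-∘ʳ f g (generated-contractive F) (generated-contractive H) faithful
      faithful-g = faithful-∘ˡ f g faithful-f faithful
    go (par {f = f} {g} F H) faithful =
      ⊗-conservative f g (go F (faithful-⊗ˡ f g cf cg faithful)) (go H (faithful-⊗ʳ f g cf cg faithful))
      where
      cf = generated-contractive F
      cg = generated-contractive H
    go (resp f≗g F) faithful u = trans (cong weight (sym (f≗g u))) (go F faithful-f u)
      where
      faithful-f = record
        { conservative = λ u h → trans (cong weight (f≗g u)) (conservative faithful u h)
        ; injective    = λ u v hu hv eq →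
            injective faithful u v hu hv (trans (sym (f≗g u)) (trans eq (f≗g v)))
        }

-- An operator that is faithful but not conservative

eraseLight : Operator n
eraseLight {n} u with 2 ≤? weight u
... | yes _ = u
... | no  _ = replicate n false

eraseLight-fixes : (u : Vec Bool n) → 2 ≤ weight u → eraseLight u ≡ u
eraseLight-fixes u 2≤w with 2 ≤? weight u
... | yes _   = refl
... | no  2≰w = contradiction 2≤w 2≰w

eraseLight-erases : (u : Vec Bool n) → weight u < 2 → eraseLight u ≡ replicate n false
eraseLight-erases u w<2 with 2 ≤? weight u
... | yes 2≤w = contradiction 2≤w (<⇒≱ w<2)
... | no  _   = refl

-- The erased vectors form a down-set and are sent to the least vector.
eraseLight-contractiveIncreasing : IsContractiveIncreasing (eraseLight {n})
eraseLight-contractiveIncreasing {n} = record { increasing = increasing ; contractive = contractive }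
  where
  increasing : {u v : Vec Bool n} → u ≼ v → eraseLight u ≼ eraseLight v
  increasing {u} {v} u≼v with 2 ≤? weight u | 2 ≤? weight v
  ... | yes _   | yes _   = u≼v
  ... | yes 2≤w | no  2≰w = contradiction (≤-trans 2≤w (weight-mono u≼v)) 2≰w
  ... | no  _   | yes _   = falses-minimum v
  ... | no  _   | no  _   = Pointwise.refl ≤-refl

  contractive : Contractive (eraseLight {n})
  contractive u with 2 ≤? weight u
  ... | yes _ = ≤-reflexive refl
  ... | no  _ = ≤-trans (≤-reflexive (weight-falses n)) z≤n

-- Among `2 + s` bits with at most `s` zeros there are at least two ones, so heavy vectors are
-- fixed.
eraseLight-faithful : ∀ s → Faithful s (eraseLight {2 + s})
eraseLight-faithful s = record
  { conservative = λ u h → cong weight (fixes u h)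
  ; injective    = λ u v hu hv eq → trans (sym (fixes u hu)) (trans eq (fixes v hv))
  }
  where
  fixes : (u : Vec Bool (2 + s)) → Heavy s u → eraseLight u ≡ u
  fixes u h = eraseLight-fixes u
    (+-cancelˡ-≤ s 2 (weight u) (≤-trans (≤-reflexive (+-comm s 2)) h))

-- A vector with a single one, available in any positive arity, loses it.
eraseLight-¬conservative : ¬ Conservative (eraseLight {suc n})
eraseLight-¬conservative {n} conservative = contradiction 0≡weight λ ()
  where
  open ≡-Reasoning

  unit : Vec Bool (suc n)
  unit = true ∷ replicate n false

  0≡weight : 0 ≡ weight unit
  0≡weight = begin
    0                                ≡⟨ weight-falses (suc n) ⟨
    weight (replicate (suc n) false) ≡⟨ cong weight (eraseLight-erases unit unit<2) ⟨
    weight (eraseLight unit)         ≡⟨ conservative unit ⟩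
    weight unit                      ∎
    where
    unit<2 : weight unit < 2
    unit<2 = s≤s (s≤s (≤-reflexive (weight-falses n)))

proposition4 : ¬ (Σ (List (∃ Operator)) λ G →
    All (λ c → IsContractiveIncreasing (proj₂ c)) G
    × (∀ (n : ℕ) (f : Operator n) → IsContractiveIncreasing f → Generated G f))
proposition4 (G , G-ci , generates) = eraseLight-¬conservative
  (generated-faithful⇒conservative (All.map IsContractiveIncreasing.contractive G-ci)
    (λ c∈G → All.lookup (xs≤max 0 (map proj₁ G)) (∈-map⁺ proj₁ c∈G))
    (generates (2 + maxArity) eraseLight eraseLight-contractiveIncreasing)
    (eraseLight-faithful maxArity))
  where
  -- The `0` is the value for an empty `G`.
  maxArity = max 0 (map proj₁ G)
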